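{- Consider the bimodal language with modalities $\Box$ and $[e]$ (with duals $\Diamond$ and $\langle e\rangle$). Let $\mathsf{vBe}$ be the smallest normal bimodal logic in this language containing $\Box\Diamond\top\rightarrow\Box(\Box(\Box p\rightarrow p)\rightarrow p)$ and $\langle e\rangle(\Box\Diamond\top\wedge\Diamond\top)$. Let $\mathscr{VBE}$ be the van Benthem frame extended by interpreting $\langle e\rangle$ by the universal relation $W\times W$, and let $\mathsf{IDe}$ be the set of all bimodal formulas valid over $\mathscr{VBE}$. Then: 1. Every normal logic extending $\mathsf{vBe}$ (in particular $\mathsf{IDe}$) is $\mathcal{V}$-inconsistent, yet $\mathsf{vBe}$ is consistent. 2. Every normal logic contained in $\mathsf{IDe}$ (in particular $\mathsf{vBe}$) is $\mathcal{A}$-consistent, and $\mathsf{IDe}$ is $\mathcal{A}$-complete.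
   Context: A normal bimodal logic is a set of formulas containing all classical tautologies and the axiom $\blacksquare(p\to q)\to(\blacksquare p\to\blacksquare q)$ for each box $\blacksquare$ of the language, closed under modus ponens, uniform substitution, and necessitation for each box. It is consistent if it does not contain all formulas. A (bimodal) BAO is a Boolean algebra with two unary operations $f$ (interpreting the diamonds), each satisfying $f(x\vee y)=f(x)\vee f(y)$ and $f(\bot)=\bot$; boxes are interpreted dually. It validates a formula if every assignment of elements to variables, extended homomorphically, sends the formula to $\top$; it is non-degenerate if $\bot\neq\top$. A $\mathcal{V}$-BAO is a BAO in which every operator $f$ is completely additive: whenever $\bigvee X$ exists, $\bigvee\{f(x)\mid x\in X\}$ exists and equals $f(\bigvee X)$. An $\mathcal{A}$-BAO is a BAO whose Boolean reduct is atomic (every non-bottom element is above an atom). A normal logic is $\mathcal{X}$-consistent if all its formulas are validated by some non-degenerate $\mathcal{X}$-BAO, and $\mathcal{X}$-inconsistent otherwise. It is $\mathcal{X}$-complete if it is exactly the set of formulas validated by all members of some class of $\mathcal{X}$-BAOs. The van Benthem frame is the general frame $\langle W,R,\mathbb{W}\rangle$ with $W=\mathbb{N}\cup\{\infty,\infty+1\}$; $R=\{\langle\infty+1,\infty\rangle,\langle\infty,\infty\rangle\}\cup\{\langle\infty,n\rangle\mid n\in\mathbb{N}\}\cup\{\langle m,n\rangle\mid m,n\in\mathbb{N},m>n\}$; $\mathbb{W}=\{X\subseteq W\mid X\text{ finite},\ \infty\notin X\}\cup\{X\subseteq W\mid X\text{ cofinite},\ \infty\in X\}$. In $\mathscr{VBE}$,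 $\Box$ is interpreted via $R$ and $[e]$ via $W\times W$. A formula is valid over a general frame if it is true at every point (usual Kripke semantics) under every valuation assigning elements of $\mathbb{W}$ to variables. -}

module Defs where

open import Level using (Level; _⊔_; suc; 0ℓ)
open import Data.Nat.Base using (ℕ; _>_)
open import Data.Bool.Base as Bool using (Bool; true; false)
open import Data.Empty using (⊥)
open import Data.Unit.Base using (⊤)
open import Data.Product.Base using (Σ; ∃; _×_; _,_)
open import Data.Sum.Base using (_⊎_)
open import Data.List.Base using (List)
open import Data.List.Membership.Propositional using () renaming (_∈_ to _∈ˡ_)
open import Function.Bundles using (_⇔_)
open import Relation.Binary.Core using (Rel)
open import Relation.Binary.Bundles using (Poset)
open import Relation.Binary.PropositionalEquality.Core using (_≡_)
open import Relation.Nullary.Negation.Core using (¬_)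
open import Relation.Unary using (Pred; _∈_; _∉_; _⊆_; _≐_; ∁)
open import Algebra.Core using (Op₁)
open import Algebra.Lattice.Bundles using (BooleanAlgebra)
import Algebra.Lattice.Properties.Lattice as LatticeProperties

private
  variable
    a c ℓ g x : Level

------------------------------------------------------------------------
-- The bimodal language

data Modality : Set where
  □-mod : Modality
  e-mod : Modality

infixr 5 _⇒_
infixr 7 _∧_

data Formula : Set where
  var : ℕ → Formula
  ⊥′  : Formula
  _⇒_ : Formula → Formula → Formula
  box : Modality → Formula → Formula

∼_ : Formula → Formula
∼ φ = φ ⇒ ⊥′

⊤′ : Formula
⊤′ = ∼ ⊥′

_∧_ : Formula → Formula → Formula
φ ∧ ψ = ∼ (φ ⇒ ∼ ψ)

dia : Modality → Formula → Formula
dia m φ = ∼ box m (∼ φ)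

□_ ◇_ [e]_ ⟨e⟩_ : Formula → Formula
□ φ   = box □-mod φ
◇ φ   = dia □-mod φ
[e] φ = box e-mod φ
⟨e⟩ φ = dia e-mod φ

infix 9 ∼_ □_ ◇_ [e]_ ⟨e⟩_

Substitution : Set
Substitution = ℕ → Formula

infixl 10 _[_]

_[_] : Formula → Substitution → Formula
var i   [ σ ] = σ i
⊥′      [ σ ] = ⊥′
(φ ⇒ ψ) [ σ ] = φ [ σ ] ⇒ ψ [ σ ]
box m φ [ σ ] = box m (φ [ σ ])

------------------------------------------------------------------------
-- Normal logics

-- Truth-table evaluation in which variables and boxed formulas are the
-- propositional atoms; t gives the truth values of these atoms.
eval : (Formula → Bool) → Formula → Bool
eval t (var i)   = t (var i)
eval t ⊥′        = false
eval t (φ ⇒ ψ)   = Bool.not (eval t φ) Bool.∨ eval t ψ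
eval t (box m φ) = t (box m φ)

Tautology : Pred Formula 0ℓ
Tautology φ = ∀ t → eval t φ ≡ true

axiomK : Modality → Formula
axiomK m = box m (p ⇒ q) ⇒ (box m p ⇒ box m q)
  where
  p q : Formula
  p = var 0
  q = var 1

record IsNormalLogic (L : Pred Formula a) : Set a where
  field
    tautology      : Tautology ⊆ L
    distribution   : ∀ m → axiomK m ∈ L
    modusPonens    : ∀ {φ ψ} → (φ ⇒ ψ) ∈ L → φ ∈ L → ψ ∈ L
    substitution   : ∀ {φ} σ → φ ∈ L → φ [ σ ] ∈ L
    necessitation  : ∀ {φ} m → φ ∈ L → box m φ ∈ L

Consistent : Pred Formula a → Set a
Consistent L = ¬ (∀ φ → φ ∈ L)

data SmallestNormal (Γ : Pred Formula g) : Pred Formula g where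
  axiom : ∀ {φ} → φ ∈ Γ → SmallestNormal Γ φ
  taut  : ∀ {φ} → Tautology φ → SmallestNormal Γ φ
  dist  : ∀ m → SmallestNormal Γ (axiomK m)
  mp    : ∀ {φ ψ} → SmallestNormal Γ (φ ⇒ ψ) → SmallestNormal Γ φ →
          SmallestNormal Γ ψ
  subst : ∀ {φ} σ → SmallestNormal Γ φ → SmallestNormal Γ (φ [ σ ])
  nec   : ∀ {φ} m → SmallestNormal Γ φ → SmallestNormal Γ (box m φ)

SmallestNormal-isNormalLogic : (Γ : Pred Formula g) →
                               IsNormalLogic (SmallestNormal Γ)
SmallestNormal-isNormalLogic Γ = record
  { tautology     = taut
  ; distribution  = dist
  ; modusPonens   = mp
  ; substitution  = subst
  ; necessitation = nec
  }

SmallestNormal-least : {Γ : Pred Formula g} {L : Pred Formula a} →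
                       IsNormalLogic L → Γ ⊆ L → SmallestNormal Γ ⊆ L
SmallestNormal-least {Γ = Γ} {L = L} isNormal Γ⊆L = go
  where
  open IsNormalLogic isNormal
  go : SmallestNormal Γ ⊆ L
  go (axiom h)   = Γ⊆L h
  go (taut h)    = tautology h
  go (dist m)    = distribution m
  go (mp h k)    = modusPonens (go h) (go k)
  go (subst σ h) = substitution σ (go h)
  go (nec m h)   = necessitation m (go h)

data vBe-Axiom : Pred Formula 0ℓ where
  vB : let p = var 0 in
       vBe-Axiom (□ ◇ ⊤′ ⇒ □ (□ (□ p ⇒ p) ⇒ p))
  eA : vBe-Axiom (⟨e⟩ (□ ◇ ⊤′ ∧ ◇ ⊤′))

vBe : Pred Formula 0ℓ
vBe = SmallestNormal vBe-Axiom

------------------------------------------------------------------------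
-- Boolean algebras with operators

record BAO c ℓ : Set (suc (c ⊔ ℓ)) where
  field
    booleanAlgebra : BooleanAlgebra c ℓ

  open BooleanAlgebra booleanAlgebra public
    renaming (_∧_ to _⊓_; _∨_ to _⊔ᵇ_; ¬_ to -_; ⊤ to 1#; ⊥ to 0#)

  field
    f      : Modality → Op₁ Carrier
    f-cong : ∀ m {x y} → x ≈ y → f m x ≈ f m y
    f-∨    : ∀ m x y → f m (x ⊔ᵇ y) ≈ f m x ⊔ᵇ f m y
    f-⊥    : ∀ m → f m 0# ≈ 0#

  open Poset (LatticeProperties.poset lattice) public using (_≤_)

  ⟦_⟧ : Formula → (ℕ → Carrier) → Carrier
  ⟦ var i ⟧   θ = θ i
  ⟦ ⊥′ ⟧      θ = 0#
  ⟦ φ ⇒ ψ ⟧   θ = (- ⟦ φ ⟧ θ) ⊔ᵇ ⟦ ψ ⟧ θ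
  ⟦ box m φ ⟧ θ = - f m (- ⟦ φ ⟧ θ)

  Validates : Pred Formula (c ⊔ ℓ)
  Validates φ = ∀ θ → ⟦ φ ⟧ θ ≈ 1#

  NonDegenerate : Set ℓ
  NonDegenerate = ¬ (0# ≈ 1#)

  -- Subsets are arbitrary predicates; they need not respect _≈_, since suprema
  -- only depend on the ≈-closure.
  Subset : Set (suc (c ⊔ ℓ))
  Subset = Pred Carrier (c ⊔ ℓ)

  IsSupremum : Subset → Pred Carrier (c ⊔ ℓ)
  IsSupremum X s = (∀ x → x ∈ X → x ≤ s)
                 × (∀ u → (∀ x → x ∈ X → x ≤ u) → s ≤ u)

  image : Op₁ Carrier → Subset → Subset
  image h X y = ∃ λ x → x ∈ X × y ≈ h x

  IsAtom : Pred Carrier (c ⊔ ℓ)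
  IsAtom b = ¬ (b ≈ 0#) × (∀ x → x ≤ b → (x ≈ 0#) ⊎ (x ≈ b))

IsV-BAO : Pred (BAO c ℓ) (suc (c ⊔ ℓ))
IsV-BAO A = ∀ m (X : Subset) s → IsSupremum X s →
            IsSupremum (image (f m) X) (f m s)
  where open BAO A

IsA-BAO : Pred (BAO c ℓ) (c ⊔ ℓ)
IsA-BAO A = ∀ x → ¬ (x ≈ 0#) → ∃ λ b → IsAtom b × b ≤ x
  where open BAO A

_-Consistent : Pred (BAO c ℓ) x → Pred Formula a →
               Set (suc (c ⊔ ℓ) ⊔ x ⊔ a)
_-Consistent {c = c} {ℓ = ℓ} X L =
  Σ (BAO c ℓ) λ A → X A × BAO.NonDegenerate A × L ⊆ BAO.Validates A

_-Inconsistent : Pred (BAO c ℓ) x → Pred Formula a →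
                 Set (suc (c ⊔ ℓ) ⊔ x ⊔ a)
(X -Inconsistent) L = ¬ (X -Consistent) L

-- The class is a predicate at the level of the type of BAOs itself, which
-- accommodates, for example, the class whose sole member is a given BAO.
_-Complete : Pred (BAO c ℓ) x → Pred Formula a →
             Set (suc (suc (c ⊔ ℓ)) ⊔ x ⊔ a)
_-Complete {c = c} {ℓ = ℓ} X L =
  Σ (Pred (BAO c ℓ) (suc (c ⊔ ℓ))) λ 𝒦 →
    𝒦 ⊆ X × (∀ φ → φ ∈ L ⇔ (∀ A → A ∈ 𝒦 → BAO.Validates A φ))

------------------------------------------------------------------------
-- The van Benthem frame

data W : Set where
  nat : ℕ → W
  ∞   : W
  ∞+1 : W

data _R_ : Rel W 0ℓ where
  ∞+1-∞   : ∞+1 R ∞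
  ∞-∞     : ∞ R ∞
  ∞-nat   : ∀ {n} → ∞ R nat n
  nat-nat : ∀ {m n} → m > n → nat m R nat n

-- Cofinite sets are complements of enumerated finite sets; classically this is
-- the same as having a finite complement.
Finite Cofinite : Pred (Pred W 0ℓ) 0ℓ
Finite   X = ∃ λ (ws : List W) → X ≐ (_∈ˡ ws)
Cofinite X = ∃ λ (ws : List W) → X ≐ ∁ (_∈ˡ ws)

𝕎 : Pred (Pred W 0ℓ) 0ℓ
𝕎 X = (Finite X × ∞ ∉ X) ⊎ (Cofinite X × ∞ ∈ X)

accessibility : Modality → Rel W 0ℓ
accessibility □-mod     = _R_
accessibility e-mod _ _ = ⊤

infix 4 _,_⊩_

_,_⊩_ : (ℕ → Pred W 0ℓ) → W → Formula → Set
V , w ⊩ var i   = w ∈ V i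
V , w ⊩ ⊥′      = ⊥
V , w ⊩ φ ⇒ ψ   = V , w ⊩ φ → V , w ⊩ ψ
V , w ⊩ box m φ = ∀ v → accessibility m w v → V , v ⊩ φ

-- Validity over the general frame: only valuations into 𝕎 are considered, and
-- [e] is read through the universal relation.
IDe : Pred Formula (suc 0ℓ)
IDe φ = ∀ V → (∀ i → V i ∈ 𝕎) → ∀ w → V , w ⊩ φ

-- V-inconsistency: let u be the value of □◇⊤ ∧ ◇⊤. Taking p = -x in the first axiom shows
-- that u is disjoint from f (löb x), where löb x = x ∧ -f (x ∧ -f x). If u were non-zero,
-- complete additivity and u ≤ f 1 would give a non-zero y such that u meets f x for every
-- non-zero x ≤ y. Then löb x = 0, that is x ≤ f (x ∧ -f x), for all x ≤ y. Applied to
-- x = y ∧ -f y this gives x ≤ f y, so x = 0, and then y ≤ f x = 0.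
--
-- A-consistency: the admissible sets of the van Benthem frame form an atomic algebra, an
-- admissible set containing ∞ having natural numbers as elements. The first axiom holds at
-- ∞+1 because an admissible set containing all naturals contains ∞.

module Submission where

open import Defs
open import Level using (Level; 0ℓ; Lift; lift)
open import Algebra.Lattice.Bundles using (BooleanAlgebra)
import Algebra.Lattice.Properties.BooleanAlgebra as BooleanAlgebraProperties
import Algebra.Lattice.Properties.Lattice as LatticeProperties
open import Algebra.Lattice.Structures using (IsBooleanAlgebra)
open import Data.Bool.Base using (Bool; true; false; not; T)
  renaming (_∧_ to _∧ᵇ_; _∨_ to _∨ᵇ_)
open import Data.Bool.Properties using (∨-∧-isBooleanAlgebra; T?; T-≡; T-∨; ∧-zeroʳ)
  renaming (_≟_ to _≟ᵇ_)
open import Data.List.Base using (List; []; _∷_; map; upTo; filter)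
open import Data.List.Membership.Propositional using () renaming (_∈_ to _∈ˡ_)
open import Data.List.Membership.Propositional.Properties
  using (∈-map⁺; ∈-upTo⁺; ∈-filter⁺; ∈-filter⁻)
open import Data.List.Relation.Unary.Any using (here; there)
open import Data.Nat.Base as ℕ using (ℕ; suc)
import Data.Nat.Properties as ℕ
open import Data.Nat.Induction using (<-rec)
open import Data.Product.Base using (∃; _×_; _,_; proj₁; proj₂)
open import Data.Sum.Base as Sum using (_⊎_; inj₁; inj₂; [_,_]′)
open import Data.Unit.Base using (tt)
open import Function.Base using (_∘_; _$_; id)
open import Function.Bundles using (_⇔_; mk⇔; Equivalence)
import Relation.Binary.Lattice as OrderTheory
open import Relation.Binary.Definitions using (DecidableEquality)
open import Relation.Binary.PropositionalEquality as ≡ using (_≡_; refl; sym; trans; cong; cong₂)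
open import Relation.Nullary.Decidable as Dec
  using (Dec; yes; no; does; proof; map′; _⊎-dec_; ¬?)
open import Relation.Nullary.Negation using (¬_; contradiction)
open import Relation.Nullary.Reflects as Reflects using (Reflects; ofʸ; ofⁿ; invert; T-reflects)
open import Relation.Unary using (Pred; _∈_; _⊆_)

private
  variable
    a c ℓ : Level

-- Boolean order and monotone diamonds in an arbitrary BAO.

module BAOProperties (A : BAO c ℓ) where
  open BAO A renaming (refl to ≈-refl; sym to ≈-sym; trans to ≈-trans)
  open BooleanAlgebraProperties booleanAlgebra public
    using (∨-identityʳ; ∧-identityʳ; ¬-involutive; deMorgan₂)
    renaming (¬⊥≈⊤ to -0≈1)
  open OrderTheory.Lattice (LatticeProperties.∨-∧-orderTheoreticLattice lattice) public
    using (x∧y≤x; x∧y≤y; ∧-greatest; x≤x∨y; y≤x∨y; ∨-least; antisym)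
    renaming (refl to ≤-refl; reflexive to ≤-reflexive; trans to ≤-trans)
  open import Relation.Binary.Reasoning.Setoid setoid

  0≤x : ∀ x → 0# ≤ x
  0≤x x = ≤-trans (≤-reflexive (≈-sym (∧-complementʳ x))) (x∧y≤x _ _)

  x≤1 : ∀ x → x ≤ 1#
  x≤1 x = ≤-trans (x≤x∨y x (- x)) (≤-reflexive (∨-complementʳ x))

  ≤0⇒≈0 : ∀ {x} → x ≤ 0# → x ≈ 0#
  ≤0⇒≈0 x≤0 = antisym x≤0 (0≤x _)

  residuate : ∀ {x y z} → x ⊓ y ≤ z → x ≤ (- y) ⊔ᵇ z
  residuate {x} {y} {z} xy≤z = ≤-trans (≤-reflexive (begin
    x                      ≈⟨ ∧-identityʳ x ⟨
    x ⊓ 1#                 ≈⟨ ∧-congˡ (∨-complementʳ y) ⟨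
    x ⊓ (y ⊔ᵇ (- y))       ≈⟨ ∧-distribˡ-∨ x y (- y) ⟩
    (x ⊓ y) ⊔ᵇ (x ⊓ (- y)) ∎))
    (∨-least (≤-trans xy≤z (y≤x∨y _ _)) (≤-trans (x∧y≤y _ _) (x≤x∨y _ _)))

  disjoint⇒≤- : ∀ {x y} → x ⊓ y ≤ 0# → x ≤ - y
  disjoint⇒≤- xy≤0 = ≤-trans (residuate xy≤0) (≤-reflexive (∨-identityʳ _))

  ≤-⇒disjoint : ∀ {x y z} → z ≤ x → z ≤ y → x ≤ - y → z ≤ 0#
  ≤-⇒disjoint z≤x z≤y x≤-y =
    ≤-trans (∧-greatest z≤y (≤-trans z≤x x≤-y)) (≤-reflexive (∧-complementʳ _))

  swap- : ∀ {x y} → x ≤ - y → y ≤ - x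
  swap- x≤-y = disjoint⇒≤- (≤-⇒disjoint (x∧y≤y _ _) (x∧y≤x _ _) x≤-y)

  disjoint-⇒≤ : ∀ {x y} → x ⊓ (- y) ≤ 0# → x ≤ y
  disjoint-⇒≤ p = ≤-trans (disjoint⇒≤- p) (≤-reflexive (¬-involutive _))

  f-mono : ∀ m {x y} → x ≤ y → f m x ≤ f m y
  f-mono m {x} {y} x≤y = ≤-trans (x≤x∨y _ _) (≤-reflexive (begin
    f m x ⊔ᵇ f m y ≈⟨ f-∨ m x y ⟨
    f m (x ⊔ᵇ y)   ≈⟨ f-cong m (antisym (∨-least x≤y ≤-refl) (y≤x∨y _ _)) ⟩
    f m y          ∎))

  -- Algebraic values of the derived connectives.

  ⟦∼⟧ : ∀ φ θ → ⟦ ∼ φ ⟧ θ ≈ - ⟦ φ ⟧ θ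
  ⟦∼⟧ φ θ = ∨-identityʳ _

  ⟦⊤′⟧ : ∀ θ → ⟦ ⊤′ ⟧ θ ≈ 1#
  ⟦⊤′⟧ θ = begin
    ⟦ ⊤′ ⟧ θ ≈⟨ ⟦∼⟧ ⊥′ θ ⟩
    - 0#     ≈⟨ -0≈1 ⟩
    1#       ∎

  ⟦∧⟧ : ∀ φ ψ θ → ⟦ φ ∧ ψ ⟧ θ ≈ ⟦ φ ⟧ θ ⊓ ⟦ ψ ⟧ θ
  ⟦∧⟧ φ ψ θ = begin
    ⟦ φ ∧ ψ ⟧ θ                          ≈⟨ ⟦∼⟧ (φ ⇒ ∼ ψ) θ ⟩
    - ((- ⟦ φ ⟧ θ) ⊔ᵇ ⟦ ∼ ψ ⟧ θ)         ≈⟨ deMorgan₂ _ _ ⟩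
    (- - ⟦ φ ⟧ θ) ⊓ (- ⟦ ∼ ψ ⟧ θ)        ≈⟨ ∧-cong (¬-involutive _) (¬-cong (⟦∼⟧ ψ θ)) ⟩
    ⟦ φ ⟧ θ ⊓ (- - ⟦ ψ ⟧ θ)              ≈⟨ ∧-congˡ (¬-involutive _) ⟩
    ⟦ φ ⟧ θ ⊓ ⟦ ψ ⟧ θ                    ∎

  ⟦dia⟧ : ∀ m φ θ → ⟦ dia m φ ⟧ θ ≈ f m (⟦ φ ⟧ θ)
  ⟦dia⟧ m φ θ = begin
    ⟦ dia m φ ⟧ θ            ≈⟨ ⟦∼⟧ (box m (∼ φ)) θ ⟩
    - - f m (- ⟦ ∼ φ ⟧ θ)    ≈⟨ ¬-involutive _ ⟩
    f m (- ⟦ ∼ φ ⟧ θ)        ≈⟨ f-cong m (¬-cong (⟦∼⟧ φ θ)) ⟩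
    f m (- - ⟦ φ ⟧ θ)        ≈⟨ f-cong m (¬-involutive _) ⟩
    f m (⟦ φ ⟧ θ)            ∎

  -- The van Benthem axiom as an inequality.

  Validates⇒≤ : ∀ {φ ψ} → Validates (φ ⇒ ψ) → ∀ θ → ⟦ φ ⟧ θ ≤ ⟦ ψ ⟧ θ
  Validates⇒≤ {φ} {ψ} valid θ = begin
    ⟦ φ ⟧ θ                                          ≈⟨ ∧-identityʳ _ ⟨
    ⟦ φ ⟧ θ ⊓ 1#                                     ≈⟨ ∧-congˡ (valid θ) ⟨
    ⟦ φ ⟧ θ ⊓ ((- ⟦ φ ⟧ θ) ⊔ᵇ ⟦ ψ ⟧ θ)               ≈⟨ ∧-distribˡ-∨ _ _ _ ⟩
    (⟦ φ ⟧ θ ⊓ (- ⟦ φ ⟧ θ)) ⊔ᵇ (⟦ φ ⟧ θ ⊓ ⟦ ψ ⟧ θ)   ≈⟨ ∨-congʳ (∧-complementʳ _) ⟩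
    0# ⊔ᵇ (⟦ φ ⟧ θ ⊓ ⟦ ψ ⟧ θ)                        ≈⟨ antisym (∨-least (0≤x _) ≤-refl) (y≤x∨y _ _) ⟩
    ⟦ φ ⟧ θ ⊓ ⟦ ψ ⟧ θ                                ∎

  -- The complement of the value of `□ (□ p ⇒ p) ⇒ p` at `p = - x`.
  löb : Carrier → Carrier
  löb x = x ⊓ (- f □-mod (x ⊓ (- f □-mod x)))

  vB⇒≤-löb : Validates (□ ◇ ⊤′ ⇒ □ (□ (□ var 0 ⇒ var 0) ⇒ var 0)) →
             ∀ x θ → ⟦ □ ◇ ⊤′ ⟧ θ ≤ - f □-mod (löb x)
  vB⇒≤-löb valid x θ =
    -- `□ ◇ ⊤′` has no variables, so its value under this assignment is also its value under `θ`.
    ≤-trans (Validates⇒≤ {φ = □ ◇ ⊤′} {ψ = □ (□ (□ var 0 ⇒ var 0) ⇒ var 0)} valid (λ _ → - x))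
      (≤-reflexive (¬-cong (f-cong □-mod (begin
        - ((- - f □-mod (- ((- - f □-mod (- - x)) ⊔ᵇ (- x)))) ⊔ᵇ (- x)) ≈⟨ flip _ ⟩
        x ⊓ (- f □-mod (- ((- - f □-mod (- - x)) ⊔ᵇ (- x))))
          ≈⟨ ∧-congˡ (¬-cong (f-cong □-mod (flip _))) ⟩
        x ⊓ (- f □-mod (x ⊓ (- f □-mod (- - x))))
          ≈⟨ ∧-congˡ (¬-cong (f-cong □-mod (∧-congˡ (¬-cong (f-cong □-mod (¬-involutive x)))))) ⟩
        löb x ∎))))
    where
    flip : ∀ z → - ((- - z) ⊔ᵇ (- x)) ≈ x ⊓ (- z)
    flip z = begin
      - ((- - z) ⊔ᵇ (- x))  ≈⟨ deMorgan₂ _ _ ⟩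
      (- - - z) ⊓ (- - x)   ≈⟨ ∧-cong (¬-involutive _) (¬-involutive _) ⟩
      (- z) ⊓ x             ≈⟨ ∧-comm _ _ ⟩
      x ⊓ (- z)             ∎

  löb-free⇒≤0 : ∀ {y} → (∀ {x} → x ≤ y → löb x ≤ 0#) → y ≤ 0#
  löb-free⇒≤0 {y} free =
    ≤-trans (self-related ≤-refl)
      (≤-trans (f-mono □-mod irreflexive≤0) (≤-reflexive (f-⊥ □-mod)))
    where
    x′ : Carrier
    x′ = y ⊓ (- f □-mod y)
    self-related : ∀ {x} → x ≤ y → x ≤ f □-mod (x ⊓ (- f □-mod x))
    self-related x≤y = disjoint-⇒≤ (free x≤y)
    irreflexive≤0 : x′ ≤ 0#
    irreflexive≤0 = ≤-⇒disjoint (x∧y≤y _ _)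
      (≤-trans (self-related (x∧y≤x _ _)) (f-mono □-mod (≤-trans (x∧y≤x _ _) (x∧y≤x _ _))))
      ≤-refl

  -- The contrapositive of the descent from 1#, which needs no excluded middle: the set of
  -- those y with f y disjoint from u contains every löb x, so its only upper bound is 1#.
  ≤-löb∧≤f1⇒≈0 : IsV-BAO A → ∀ {u} → (∀ x → u ≤ - f □-mod (löb x)) → u ≤ f □-mod 1# → u ≈ 0#
  ≤-löb∧≤f1⇒≈0 completelyAdditive {u} u≤-löb u≤f1 = ≤0⇒≈0 (≤-⇒disjoint u≤f1 ≤-refl f1≤-u)
    where
    X : Subset
    X y = Lift c (f □-mod y ≤ - u)

    -- For `x` below `- t`, `löb x` lies below `x`, hence below `- t`; being in `X`, it also lies
    -- below `t`. So `löb` vanishes on everything below `- t`, which makes `- t` zero.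
    1≤bound : ∀ t → (∀ y → y ∈ X → y ≤ t) → 1# ≤ t
    1≤bound t bound = disjoint-⇒≤ (≤-trans (x∧y≤y _ _) (löb-free⇒≤0 λ {x} x≤-t →
      ≤-⇒disjoint (≤-trans (x∧y≤x _ _) x≤-t) (bound (löb x) (lift (swap- (u≤-löb x)))) ≤-refl))

    -- By complete additivity `f □-mod 1#` is the supremum of the image of `X`, and `- u` bounds
    -- that image by the choice of `X`.
    f1≤-u : f □-mod 1# ≤ - u
    f1≤-u = proj₂ (completelyAdditive □-mod X 1# ((λ y _ → x≤1 y) , 1≤bound)) (- u)
      λ { _ (_ , lift fx≤-u , y≈fx) → ≤-trans (≤-reflexive y≈fx) fx≤-u }

-- Inconsistency over completely additive algebras.

V-inconsistent : (L : Pred Formula a) → vBe ⊆ L → (IsV-BAO {c} {ℓ} -Inconsistent) L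
-- The second axiom gives `⟨e⟩ φ` the value `1#`, but `φ` has value `0#`, which the diamond
-- preserves.
V-inconsistent L vBe⊆L (A , isV , nonDegenerate , valid) = nonDegenerate (begin
  0#                             ≈⟨ f-⊥ e-mod ⟨
  f e-mod 0#                     ≈⟨ f-cong e-mod u≈0 ⟨
  f e-mod (⟦ φ ⟧ θ)              ≈⟨ ⟦dia⟧ e-mod φ θ ⟨
  ⟦ ⟨e⟩ φ ⟧ θ                    ≈⟨ valid (vBe⊆L (axiom eA)) θ ⟩
  1#                             ∎)
  where
  open BAO A renaming (trans to ≈-trans)
  open BAOProperties A
  open import Relation.Binary.Reasoning.Setoid setoid
  φ : Formula
  φ = □ ◇ ⊤′ ∧ ◇ ⊤′
  θ : ℕ → Carrier
  -- An arbitrary choice: `φ` is variable-free.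
  θ _ = 0#
  u≤ : ⟦ φ ⟧ θ ≤ ⟦ □ ◇ ⊤′ ⟧ θ ⊓ ⟦ ◇ ⊤′ ⟧ θ
  u≤ = ≤-reflexive (⟦∧⟧ (□ ◇ ⊤′) (◇ ⊤′) θ)
  u≈0 : ⟦ φ ⟧ θ ≈ 0#
  u≈0 = ≤-löb∧≤f1⇒≈0 isV
    (λ x → ≤-trans u≤ (≤-trans (x∧y≤x _ _) (vB⇒≤-löb (valid (vBe⊆L (axiom vB))) x θ)))
    (≤-trans u≤ (≤-trans (x∧y≤y _ _)
      (≤-reflexive (≈-trans (⟦dia⟧ □-mod ⊤′ θ) (f-cong □-mod (⟦⊤′⟧ θ))))))

-- Points of the frame and bounds for finite lists of them.

infix 4 _≟_

_≟_ : DecidableEquality W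
nat m ≟ nat n = map′ (cong nat) (λ { refl → refl }) (m ℕ.≟ n)
nat _ ≟ ∞     = no λ ()
nat _ ≟ ∞+1   = no λ ()
∞     ≟ nat _ = no λ ()
∞     ≟ ∞     = yes refl
∞     ≟ ∞+1   = no λ ()
∞+1   ≟ nat _ = no λ ()
∞+1   ≟ ∞     = no λ ()
∞+1   ≟ ∞+1   = yes refl

open import Data.List.Membership.DecPropositional _≟_ using (_∈?_)

-- The successor makes `bound ws` strictly larger than every natural in `ws`; the two infinite
-- points impose no bound.
rank : W → ℕ
rank (nat n) = suc n
rank ∞       = 0
rank ∞+1     = 0

bound : List W → ℕ
bound []       = 0
bound (w ∷ ws) = rank w ℕ.⊔ bound ws

rank≤bound : ∀ {w ws} → w ∈ˡ ws → rank w ℕ.≤ bound ws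
rank≤bound (here refl)          = ℕ.m≤m⊔n _ _
rank≤bound {ws = v ∷ _} (there i) = ℕ.≤-trans (rank≤bound i) (ℕ.m≤n⊔m (rank v) _)

bound≤⇒∉ : ∀ ws {n} → bound ws ℕ.≤ n → ¬ (nat n ∈ˡ ws)
bound≤⇒∉ ws b≤n i = ℕ.<⇒≱ (rank≤bound i) b≤n

-- The Boolean algebra of admissible sets.

module ClopenAlgebra (c ℓ : Level) where

  -- The admissible sets 𝕎 as decision procedures: a subset of W is finite without ∞
  -- or cofinite with ∞ exactly when almost all naturals agree with ∞ about it.
  record Clopen : Set c where
    field
      χ         : W → Bool
      threshold : ℕ
      χ-limit   : ∀ {n} → threshold ℕ.≤ n → χ (nat n) ≡ χ ∞

  open Clopen

  infix 4 _≈_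

  -- Agreement at every point, since one set can carry different thresholds. The record lets the
  -- equality live at any level.
  record _≈_ (x y : Clopen) : Set ℓ where
    constructor pointwise
    field at : ∀ w → χ x w ≡ χ y w

  open _≈_

  constant : Bool → Clopen
  constant b = record { χ = λ _ → b ; threshold = 0 ; χ-limit = λ _ → refl }

  complement : Clopen → Clopen
  complement x = record
    { χ = not ∘ χ x ; threshold = threshold x ; χ-limit = cong not ∘ χ-limit x }

  zipWith : (Bool → Bool → Bool) → Clopen → Clopen → Clopen
  zipWith _∙_ x y = record
    { χ         = λ w → χ x w ∙ χ y w
    ; threshold = threshold x ℕ.⊔ threshold y
    ; χ-limit   = λ ≤n → cong₂ _∙_
        (χ-limit x (ℕ.≤-trans (ℕ.m≤m⊔n _ _) ≤n))
        (χ-limit y (ℕ.≤-trans (ℕ.m≤n⊔m (threshold x) _) ≤n))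
    }

  clopenBooleanAlgebra : BooleanAlgebra c ℓ
  clopenBooleanAlgebra = record
    { Carrier = Clopen
    ; _≈_ = _≈_
    ; _∨_ = zipWith _∨ᵇ_
    ; _∧_ = zipWith _∧ᵇ_
    ; ¬_ = complement
    ; ⊤ = constant true
    ; ⊥ = constant false
    ; isBooleanAlgebra = record
      { isDistributiveLattice = record
        { isLattice = record
          { isEquivalence = record
            { refl  = pointwise λ _ → refl
            ; sym   = λ p → pointwise λ w → sym (at p w)
            ; trans = λ p q → pointwise λ w → trans (at p w) (at q w)
            }
          ; ∨-comm     = λ x y → pointwise λ w → B.∨-comm (χ x w) (χ y w)
          ; ∨-assoc    = λ x _ _ → pointwise λ w → B.∨-assoc (χ x w) _ _
          ; ∨-cong     = λ p q → pointwise λ w → cong₂ _∨ᵇ_ (at p w) (at q w)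
          ; ∧-comm     = λ x y → pointwise λ w → B.∧-comm (χ x w) (χ y w)
          ; ∧-assoc    = λ x _ _ → pointwise λ w → B.∧-assoc (χ x w) _ _
          ; ∧-cong     = λ p q → pointwise λ w → cong₂ _∧ᵇ_ (at p w) (at q w)
          ; absorptive = (λ x y → pointwise λ w → B.∨-absorbs-∧ (χ x w) (χ y w))
                       , (λ x y → pointwise λ w → B.∧-absorbs-∨ (χ x w) (χ y w))
          }
        ; ∨-distrib-∧ = (λ x _ _ → pointwise λ w → B.∨-distribˡ-∧ (χ x w) _ _)
                      , (λ x y z → pointwise λ w → B.∨-distribʳ-∧ (χ x w) (χ y w) (χ z w))
        ; ∧-distrib-∨ = (λ x _ _ → pointwise λ w → B.∧-distribˡ-∨ (χ x w) _ _)
                      , (λ x y z → pointwise λ w → B.∧-distribʳ-∨ (χ x w) (χ y w) (χ z w))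
        }
      ; ∨-complement = (λ x → pointwise λ w → B.∨-complementˡ (χ x w))
                     , (λ x → pointwise λ w → B.∨-complementʳ (χ x w))
      ; ∧-complement = (λ x → pointwise λ w → B.∧-complementˡ (χ x w))
                     , (λ x → pointwise λ w → B.∧-complementʳ (χ x w))
      ; ¬-cong = λ p → pointwise λ w → cong not (at p w)
      }
    }
    where module B = IsBooleanAlgebra ∨-∧-isBooleanAlgebra

  -- Deciding and interpreting the two diamonds.

  ∃<? : ∀ x n → Dec (∃ λ m → m ℕ.< n × T (χ x (nat m)))
  ∃<? x = ℕ.anyUpTo? (λ m → T? (χ x (nat m)))

  -- Beyond the threshold a natural agrees with `∞`. A search through all naturals thus reduces to
  -- `∞` and finitely many of them, which is what makes `successor?` possible at `∞` and for
  -- `e-mod`.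
  nat⇒∞⊎< : ∀ x m → T (χ x (nat m)) →
            T (χ x ∞) ⊎ ∃ λ n → n ℕ.< threshold x × T (χ x (nat n))
  nat⇒∞⊎< x m t with m ℕ.<? threshold x
  ... | yes m<N = inj₂ (m , m<N , t)
  ... | no  m≮N = inj₁ (≡.subst T (χ-limit x (ℕ.≮⇒≥ m≮N)) t)

  Successor : Modality → Clopen → W → Set
  Successor m x w = ∃ λ v → accessibility m w v × T (χ x v)

  successor? : ∀ m x w → Dec (Successor m x w)
  successor? □-mod x (nat n) = map′
    (λ (m , m<n , t) → nat m , nat-nat m<n , t)
    (λ { (nat m , nat-nat m<n , t) → m , m<n , t })
    (∃<? x n)
  successor? □-mod x ∞ = map′
    [ (λ t → ∞ , ∞-∞ , t) , (λ (m , _ , t) → nat m , ∞-nat , t) ]′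
    (λ { (∞ , _ , t) → inj₁ t ; (nat m , _ , t) → nat⇒∞⊎< x m t })
    (T? (χ x ∞) ⊎-dec ∃<? x (threshold x))
  successor? □-mod x ∞+1 = map′
    (λ t → ∞ , ∞+1-∞ , t)
    (λ { (∞ , _ , t) → t })
    (T? (χ x ∞))
  successor? e-mod x _ = map′
    [ (λ t → ∞+1 , tt , t)
    , [ (λ t → ∞ , tt , t) , (λ (m , _ , t) → nat m , tt , t) ]′ ]′
    (λ { (∞+1 , _ , t) → inj₁ t
       ; (∞ , _ , t) → inj₂ (inj₁ t)
       ; (nat m , _ , t) → inj₂ (nat⇒∞⊎< x m t) })
    (T? (χ x ∞+1) ⊎-dec (T? (χ x ∞) ⊎-dec ∃<? x (threshold x)))

  possibly : Modality → Clopen → Clopen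
  possibly m x = record
    { χ = λ w → does (successor? m x w) ; threshold = suc (threshold x) ; χ-limit = limit m }
    where
    -- If ∞ ∈ x, the threshold itself is a witness below n.
    limit : ∀ m {n} → threshold x ℕ.< n →
            does (successor? m x (nat n)) ≡ does (successor? m x ∞)
    -- The search for `e-mod` does not depend on the starting point.
    limit e-mod _ = refl
    limit □-mod {n} N<n = Dec.does-⇔ (mk⇔ to from)
      (successor? □-mod x (nat n)) (successor? □-mod x ∞)
      where
      to : Successor □-mod x (nat n) → Successor □-mod x ∞
      to (_ , nat-nat _ , t) = _ , ∞-nat , t
      atThreshold : T (χ x ∞) → Successor □-mod x (nat n)
      atThreshold t = nat (threshold x) , nat-nat N<n , ≡.subst T (sym (χ-limit x ℕ.≤-refl)) t
      from : Successor □-mod x ∞ → Successor □-mod x (nat n)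
      from (∞ , _ , t) = atThreshold t
      from (nat m , _ , t) with nat⇒∞⊎< x m t
      ... | inj₁ t∞             = atThreshold t∞
      ... | inj₂ (k , k<N , tk) = nat k , nat-nat (ℕ.<-trans k<N N<n) , tk

  clopenBAO : BAO c ℓ
  clopenBAO = record
    { booleanAlgebra = clopenBooleanAlgebra
    ; f = possibly
    ; f-cong = λ m {x} {y} p → pointwise λ w → Dec.does-⇔
        (mk⇔ (λ (v , r , t) → v , r , ≡.subst T (at p v) t)
             (λ (v , r , t) → v , r , ≡.subst T (sym (at p v)) t))
        (successor? m x w) (successor? m y w)
    ; f-∨ = λ m x y → pointwise λ w → Dec.does-⇔
        (mk⇔ (λ (v , r , t) → Sum.map (λ s → v , r , s) (λ s → v , r , s) (Equivalence.to T-∨ t))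
             [ (λ (v , r , t) → v , r , Equivalence.from T-∨ (inj₁ t))
             , (λ (v , r , t) → v , r , Equivalence.from (T-∨ {χ x v}) (inj₂ t)) ]′)
        (successor? m (zipWith _∨ᵇ_ x y) w) (successor? m x w ⊎-dec successor? m y w)
    ; f-⊥ = λ m → pointwise λ w → Dec.dec-false (successor? m (constant false) w) λ ()
    }

  open BAO clopenBAO using (⟦_⟧; Validates; NonDegenerate; IsAtom; 0#; _≤_)

  -- Kripke truth against algebraic values.

  Represents : Clopen → Pred W 0ℓ → Set
  Represents x X = ∀ w → Reflects (X w) (χ x w)

  -- The algebra computes a box as the absence of a counterexample. Since membership in `x` is
  -- decided, this absence yields the universal statement constructively.
  box-represents : ∀ m x {X} → Represents x X → ∀ w →
                   Reflects (∀ v → accessibility m w v → X v)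
                            (not (does (successor? m (complement x) w)))
  box-represents m x rep w with successor? m (complement x) w
  ... | yes (v , r , t) = ofⁿ λ all → refute (rep v) t (all v r)
    where
    refute : ∀ {P : Set} {b} → Reflects P b → T (not b) → ¬ P
    refute (ofⁿ ¬p) _ = ¬p
  ... | no none = ofʸ λ v r → prove (rep v) λ t → none (v , r , t)
    where
    prove : ∀ {P : Set} {b} → Reflects P b → ¬ T (not b) → P
    prove (ofʸ p) _  = p
    prove (ofⁿ _) ¬t = contradiction tt ¬t

  -- Induction on the formula also shows that Kripke truth is decidable, so the constructive `⇒` of
  -- the semantics agrees with the Boolean one.
  truth : ∀ {V θ} → (∀ i → Represents (θ i) (V i)) →
          ∀ φ → Represents (⟦ φ ⟧ θ) (λ w → V , w ⊩ φ)
  truth rep (var i)   = rep i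
  truth rep ⊥′        = λ _ → ofⁿ id
  truth rep (φ ⇒ ψ)   = λ w → truth rep φ w Reflects.→-reflects truth rep ψ w
  truth rep (box m φ) = box-represents m _ (truth rep φ)

  -- Admissible sets against decision procedures.

  fromList : (ws : List W) → ¬ (∞ ∈ˡ ws) → Clopen
  fromList ws ∞∉ws = record
    { χ         = λ w → does (w ∈? ws)
    ; threshold = bound ws
    ; χ-limit   = λ {n} b≤n → trans (Dec.dec-false (nat n ∈? ws) (bound≤⇒∉ ws b≤n))
                                    (sym (Dec.dec-false (∞ ∈? ws) ∞∉ws))
    }

  ∈𝕎⇒represented : ∀ {X} → X ∈ 𝕎 → ∃ λ x → Represents x X
  ∈𝕎⇒represented (inj₁ ((ws , X⊆ , ⊆X) , ∞∉X)) =
    fromList ws (∞∉X ∘ ⊆X) , λ w → proof (map′ ⊆X X⊆ (w ∈? ws))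
  ∈𝕎⇒represented (inj₂ ((ws , X⊆ , ⊆X) , ∞∈X)) =
    complement (fromList ws (X⊆ ∞∈X)) , λ w → proof (map′ ⊆X X⊆ (¬? (w ∈? ws)))

  -- By `χ-limit`, only `∞+1` and the naturals below the threshold can disagree with `∞`.
  exceptions : ∀ x → ∃ λ ws → ∀ w → w ∈ˡ ws ⇔ (¬ χ x w ≡ χ x ∞)
  exceptions x = filter exceptional? candidates , λ w → mk⇔
    (λ i → proj₂ (∈-filter⁻ exceptional? {xs = candidates} i))
    (λ e → ∈-filter⁺ exceptional? (candidate w e) e)
    where
    exceptional? : ∀ w → Dec (¬ χ x w ≡ χ x ∞)
    exceptional? w = ¬? (χ x w ≟ᵇ χ x ∞)
    candidates : List W
    candidates = ∞+1 ∷ map nat (upTo (threshold x))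
    candidate : ∀ w → ¬ χ x w ≡ χ x ∞ → w ∈ˡ candidates
    candidate ∞+1     e = here refl
    candidate ∞       e = contradiction refl e
    candidate (nat n) e = there (∈-map⁺ nat (∈-upTo⁺ (ℕ.≰⇒> (e ∘ χ-limit x))))

  -- The exceptional points form the set itself when `∞` is outside it, and its complement when `∞`
  -- is inside.
  represented⇒∈𝕎 : ∀ x → (λ w → T (χ x w)) ∈ 𝕎
  represented⇒∈𝕎 x with χ x ∞ | exceptions x
  ... | false | ws , ws⇔ = inj₁
    ( (ws , (λ {w} t → Equivalence.from (ws⇔ w) (T⇒≢false t))
          , (λ {w} i → ≢false⇒T (Equivalence.to (ws⇔ w) i)))
    , id )
    where
    T⇒≢false : ∀ {b} → T b → ¬ b ≡ false
    T⇒≢false {true} _ ()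
    ≢false⇒T : ∀ {b} → ¬ b ≡ false → T b
    ≢false⇒T {true}  _ = tt
    ≢false⇒T {false} e = e refl
  ... | true | ws , ws⇔ = inj₂
    ( (ws , (λ {w} t i → Equivalence.to (ws⇔ w) i (Equivalence.to T-≡ t))
          , (λ {w} ∉ws → Equivalence.from T-≡
              (Dec.decidable-stable (χ x w ≟ᵇ true) (∉ws ∘ Equivalence.from (ws⇔ w)))))
    , tt )

  -- Assignments into the algebra and admissible valuations represent one another, and `truth`
  -- transfers the values.
  IDe⇔Validates : ∀ φ → φ ∈ IDe ⇔ Validates φ
  IDe⇔Validates φ = mk⇔
    (λ valid θ → pointwise λ w →
      Reflects.det (truth (λ i w → T-reflects _) φ w)
                   (ofʸ (valid (λ i w → T (χ (θ i) w)) (represented⇒∈𝕎 ∘ θ) w)))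
    (λ valid V V∈𝕎 w → invert (≡.subst (Reflects _)
      (at (valid (proj₁ ∘ ∈𝕎⇒represented ∘ V∈𝕎)) w)
      (truth (λ i → proj₂ (∈𝕎⇒represented (V∈𝕎 i))) φ w)))

  -- The logic of the frame is normal.

  ⟦⟧-subst : ∀ φ σ θ → ⟦ φ [ σ ] ⟧ θ ≡ ⟦ φ ⟧ (λ i → ⟦ σ i ⟧ θ)
  ⟦⟧-subst (var i)   σ θ = refl
  ⟦⟧-subst ⊥′        σ θ = refl
  ⟦⟧-subst (φ ⇒ ψ)   σ θ =
    cong₂ (zipWith _∨ᵇ_) (cong complement (⟦⟧-subst φ σ θ)) (⟦⟧-subst ψ σ θ)
  ⟦⟧-subst (box m φ) σ θ =
    cong (λ x → complement (possibly m (complement x))) (⟦⟧-subst φ σ θ)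

  -- Evaluating at one point turns an assignment into a truth table for variables and boxed
  -- formulas, so tautologies are valid.
  eval-at : ∀ θ w φ → eval (λ ψ → χ (⟦ ψ ⟧ θ) w) φ ≡ χ (⟦ φ ⟧ θ) w
  eval-at θ w (var i)   = refl
  eval-at θ w ⊥′        = refl
  eval-at θ w (φ ⇒ ψ)   = cong₂ (λ a b → not a ∨ᵇ b) (eval-at θ w φ) (eval-at θ w ψ)
  eval-at θ w (box m φ) = refl

  -- Tautologies and substitution go through the algebra: the first need Boolean truth values, the
  -- second that values of formulas are again admissible. The rest holds directly on the frame.
  IDe-isNormalLogic : IsNormalLogic IDe
  IDe-isNormalLogic = record
    { tautology     = λ {φ} taut → Equivalence.from (IDe⇔Validates φ) λ θ → pointwise λ w →
                        trans (sym (eval-at θ w φ)) (taut _)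
    ; distribution  = λ m V _ w h k v r → h v r (k v r)
    ; modusPonens   = λ h k V V∈𝕎 w → h V V∈𝕎 w (k V V∈𝕎 w)
    ; substitution  = λ {φ} σ h → Equivalence.from (IDe⇔Validates (φ [ σ ])) λ θ →
                        ≡.subst (_≈ constant true) (sym (⟦⟧-subst φ σ θ))
                          (Equivalence.to (IDe⇔Validates φ) h _)
    ; necessitation = λ m h V V∈𝕎 w v _ → h V V∈𝕎 v
    }

  -- Atomicity and its consequences.

  nonDegenerate : NonDegenerate
  nonDegenerate 0≈1 with at 0≈1 ∞
  ... | ()

  -- Atoms will be singletons, and the singleton of `∞` is not admissible, so a point other than `∞`
  -- is required.
  isolatedPoint : ∀ x → ¬ x ≈ 0# → ∃ λ w → ¬ (w ≡ ∞) × T (χ x w)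
  -- The universal diamond serves as a decidable test for non-emptiness.
  isolatedPoint x x≉0 with successor? e-mod x ∞
  ... | yes (nat n , _ , t) = nat n , (λ ()) , t
  ... | yes (∞+1 , _ , t)   = ∞+1 , (λ ()) , t
  ... | yes (∞ , _ , t)     =
    nat (threshold x) , (λ ()) , ≡.subst T (sym (χ-limit x ℕ.≤-refl)) t
  ... | no none = contradiction (pointwise λ w → ¬T⇒≡false (λ t → none (w , tt , t))) x≉0
    where
    ¬T⇒≡false : ∀ {b} → ¬ T b → b ≡ false
    ¬T⇒≡false {true}  ¬t = contradiction tt ¬t
    ¬T⇒≡false {false} _  = refl

  singleton : ∀ w → ¬ w ≡ ∞ → Clopen
  singleton w w≢∞ = fromList (w ∷ []) λ { (here ∞≡w) → w≢∞ (sym ∞≡w) }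

  singleton-isAtom : ∀ w w≢∞ → IsAtom (singleton w w≢∞)
  singleton-isAtom w w≢∞ = nonZero , below
    where
    b : Clopen
    b = singleton w w≢∞
    nonZero : ¬ b ≈ 0#
    nonZero b≈0 with trans (sym (Dec.dec-true (w ∈? (w ∷ [])) (here refl))) (at b≈0 w)
    ... | ()
    below : ∀ y → y ≤ b → y ≈ 0# ⊎ y ≈ b
    -- Off `w`, `y ≤ b` forces `y` to be false, so its value at `w` settles the case.
    below y y≤b with χ y w in yw
    ... | true  = inj₂ (pointwise agree)
      where
      agree : ∀ v → χ y v ≡ χ b v
      agree v with v ≟ w | at y≤b v
      ... | yes refl | _ = yw
      ... | no _ | yv = trans yv (∧-zeroʳ _)
    ... | false = inj₁ (pointwise agree)
      where
      agree : ∀ v → χ y v ≡ false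
      agree v with v ≟ w | at y≤b v
      ... | yes refl | _ = yw
      ... | no _ | yv = trans yv (∧-zeroʳ _)

  singleton-≤ : ∀ x w w≢∞ → T (χ x w) → singleton w w≢∞ ≤ x
  singleton-≤ x w w≢∞ t = pointwise agree
    where
    agree : ∀ v → χ (singleton w w≢∞) v ≡ χ (singleton w w≢∞) v ∧ᵇ χ x v
    agree v with v ≟ w
    ... | yes refl = sym (Equivalence.to T-≡ t)
    ... | no _            = refl

  isA-BAO : IsA-BAO clopenBAO
  isA-BAO x x≉0 = let w , w≢∞ , t = isolatedPoint x x≉0 in
    singleton w w≢∞ , singleton-isAtom w w≢∞ , singleton-≤ x w w≢∞ t

  A-consistent : (L : Pred Formula a) → L ⊆ IDe → (IsA-BAO {c} {ℓ} -Consistent) L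
  A-consistent L L⊆IDe =
    clopenBAO , isA-BAO , nonDegenerate , λ {φ} φ∈L → Equivalence.to (IDe⇔Validates φ) (L⊆IDe φ∈L)

  -- A class with a single member suffices, because `IDe` is exactly the logic of `clopenBAO`.
  IDe-A-complete : (IsA-BAO {c} {ℓ} -Complete) IDe
  IDe-A-complete = (_≡ clopenBAO) , (λ { refl → isA-BAO }) , λ φ → mk⇔
    (λ { φ∈IDe _ refl → Equivalence.to (IDe⇔Validates φ) φ∈IDe })
    (λ valid → Equivalence.from (IDe⇔Validates φ) (valid clopenBAO refl))

-- Validity of the axioms of `vBe` on the frame.

open ClopenAlgebra using (A-consistent; IDe-A-complete)
open ClopenAlgebra 0ℓ 0ℓ using (IDe-isNormalLogic; IDe⇔Validates; nonDegenerate; constant)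

-- A finite set misses the natural number at its bound, so the set must be of the cofinite kind.
contains-nats⇒∋∞ : ∀ {X} → X ∈ 𝕎 → (∀ n → nat n ∈ X) → ∞ ∈ X
contains-nats⇒∋∞ (inj₁ ((ws , X⊆ , _) , _)) nats =
  contradiction (X⊆ (nats (bound ws))) (bound≤⇒∉ ws ℕ.≤-refl)
contains-nats⇒∋∞ (inj₂ (_ , ∞∈X)) _ = ∞∈X

vBe⊆IDe : vBe ⊆ IDe
vBe⊆IDe = SmallestNormal-least IDe-isNormalLogic λ { vB → vB-valid ; eA → eA-valid }
  where
  ∞⊩◇⊤ : ∀ {V} → V , ∞ ⊩ ◇ ⊤′
  ∞⊩◇⊤ h = h ∞ ∞-∞ id

  0⊮◇⊤ : ∀ {V} → ¬ (V , nat 0 ⊩ ◇ ⊤′)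
  0⊮◇⊤ h = h λ { _ (nat-nat ()) }

  eA-valid : IDe (⟨e⟩ (□ ◇ ⊤′ ∧ ◇ ⊤′))
  -- The witness is `∞+1`: its only successor `∞` is reflexive.
  eA-valid V _ _ h = h ∞+1 tt λ k → k (λ { _ ∞+1-∞ → ∞⊩◇⊤ {V} }) λ h′ → h′ ∞ ∞+1-∞ id

  vB-valid : IDe (□ ◇ ⊤′ ⇒ □ (□ (□ var 0 ⇒ var 0) ⇒ var 0))
  -- At `∞`, `löb` makes `var 0` progressive along the naturals, so strong induction puts all of
  -- them in `V 0`.
  vB-valid V V∈𝕎 ∞+1 _ _ ∞+1-∞ löb = contains-nats⇒∋∞ (V∈𝕎 0) $
    <-rec (λ n → nat n ∈ V 0) λ n below →
      löb (nat n) ∞-nat λ { _ (nat-nat m<n) → below m<n }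
  -- `∞` and the positive naturals see the dead end `nat 0`, which refutes `□ ◇ ⊤′`; at `nat 0`
  -- itself the outer box is vacuous.
  vB-valid V _ ∞ h = contradiction (h (nat 0) ∞-nat) (0⊮◇⊤ {V})
  vB-valid V _ (nat 0) _ _ (nat-nat ())
  vB-valid V _ (nat (suc n)) h = contradiction (h (nat 0) (nat-nat ℕ.z<s)) (0⊮◇⊤ {V})

vBe-consistent : Consistent vBe
vBe-consistent all = nonDegenerate
  (Equivalence.to (IDe⇔Validates ⊥′) (vBe⊆IDe (all ⊥′)) λ _ → constant false)

theorem5p3 : (a c ℓ : Level) →
    ( (∀ (L : Pred Formula a) → IsNormalLogic L → vBe ⊆ L →
    (IsV-BAO {c} {ℓ} -Inconsistent) L)
    × (IsNormalLogic IDe × vBe ⊆ IDe × (IsV-BAO {c} {ℓ} -Inconsistent) IDe)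
    × Consistent vBe )
    ×
    ( (∀ (L : Pred Formula a) → IsNormalLogic L → L ⊆ IDe →
    (IsA-BAO {c} {ℓ} -Consistent) L)
    × (IsNormalLogic vBe × (IsA-BAO {c} {ℓ} -Consistent) vBe)
    × (IsA-BAO {c} {ℓ} -Complete) IDe )
theorem5p3 a c ℓ =
  ( (λ L _ → V-inconsistent L)
  , (IDe-isNormalLogic , (λ {φ} → vBe⊆IDe {φ}) , V-inconsistent IDe (λ {φ} → vBe⊆IDe {φ}))
  , vBe-consistent )
  ,
  ( (λ L _ → A-consistent c ℓ L)
  , (SmallestNormal-isNormalLogic vBe-Axiom , A-consistent c ℓ vBe (λ {φ} → vBe⊆IDe {φ}))
  , IDe-A-complete c ℓ )
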